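{- Let $k,q\ge1$ be integers and let $X$, the residues $\alpha_1,\dots,\alpha_q\in\mathbb Z_\ell$, the graphs $J_{i,a}$ and the partitions $E_{i,a}$ ($i\in[k]$, $a\in[q]$) be as defined in the context. Fix $i\in[k]$. For any $a,b\in[q]$ with $a\neq b$, \[ E_{i,a}\vee E_{i,b}=\mathbf 1_X . \] Equivalently, the graph $J_{i,a}\cup J_{i,b}$ on vertex set $X$ is connected.
   Context: Partitions of a finite set $W$ are ordered by refinement ($\pi\preceq\sigma$ iff every block of $\pi$ is contained in a block of $\sigma$); $\pi\vee\sigma$ is the finest partition coarser than both; $\mathbf 1_W=\{W\}$ is the one-block partition. For a graph $H$ on vertex set $W$ (isolated vertices allowed), $\mathrm{cc}(H)$ is the partition of $W$ into connected components of $H$. The union of graphs on the same vertex set is the graph with the union of the edge sets. $[m]=\{1,\dots,m\}$. Construction (additive-shift verifier). Let $M_0=\max\{q,2^k\}$ and let $\ell$ be a prime with $M_0<\ell<2M_0$. Let $\alpha_1,\dots,\alpha_q\in\mathbb Z_\ell$ be pairwise distinct residues. Let $X=\{\bot\}\cup(2^{[k]}\times\mathbb Z_\ell)$, where $\bot$ is an extra point. For $i\in[k]$ and $a\in[q]$, $J_{i,a}$ is the graph on $X$ with exactly the following edges: (1) for every $S\subseteq[k]$, the edge between $\bot$ and $(S,0)$; (2) for every $S\subseteq[k]\setminus\{i\}$ and every $t\in\mathbb Z_\ell$, the edge between $(S,t)$ and $(S\cup\{i\},t+\alpha_a)$ (addition modulo $\ell$). Put $E_{i,a}=\mathrm{cc}(J_{i,a})$.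 -}

module Defs where

open import Data.Empty using (⊥-elim)
open import Data.Fin using (Fin; toℕ)
open import Data.Fin.Subset using (Subset; _∈_; _∉_; ⁅_⁆) renaming (_∪_ to _∪ˢ_)
open import Data.Fin.Subset.Properties using (x∈⁅x⁆; q⊆p∪q)
open import Data.Nat using (ℕ; NonZero) renaming (_+_ to _+ℕ_)
open import Data.Nat.DivMod using (_mod_)
open import Data.Nat.Primality using (Prime; prime⇒nonZero)
open import Data.Product using (∃; _,_)
open import Data.Sum using (inj₁; inj₂; [_,_])
open import Data.Unit using (⊤; tt)
open import Level using (0ℓ)
open import Relation.Binary using
  (Rel; IsEquivalence; Symmetric; Irreflexive; _⇒_; _⇔_)
open import Relation.Binary.Construct.Closure.Equivalence as EqC using (EqClosure)
open import Relation.Binary.Construct.Closure.ReflexiveTransitive as Star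
  using (Star)
open import Relation.Binary.Construct.Closure.Symmetric as Sym using (SymClosure)
import Relation.Binary.Construct.Union as Union
open import Relation.Binary.Lattice.Structures using (IsJoinSemilattice)
open import Relation.Binary.PropositionalEquality using (_≡_; refl; sym; subst)
open import Relation.Unary using (Pred; _⊆_)

-- A partition is given by the relation "x and y lie in the same block";
-- its blocks are the classes  block π x.
record Partition (W : Set) : Set₁ where
  field
    _∼_           : Rel W 0ℓ
    isEquivalence : IsEquivalence _∼_

  block : W → Pred W 0ℓ
  block x y = x ∼ y

open Partition using (block)

module _ {W : Set} where

  infix 4 _≼_ _≈_
  infixr 6 _∨_

  _≼_ : Rel (Partition W) 0ℓ
  π ≼ σ = ∀ x → ∃ λ y → block π x ⊆ block σ y

  _≈_ : Rel (Partition W) 0ℓ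
  π ≈ σ = Partition._∼_ π ⇔ Partition._∼_ σ

  _∨_ : Partition W → Partition W → Partition W
  π ∨ σ = record
    { _∼_           = EqClosure (Partition._∼_ π Union.∪ Partition._∼_ σ)
    ; isEquivalence = EqC.isEquivalence _
    }

  𝟏 : Partition W
  𝟏 = record
    { _∼_           = λ _ _ → ⊤
    ; isEquivalence = record
      { refl = tt ; sym = λ _ → tt ; trans = λ _ _ → tt }
    }

  ≼⇒⇒ : ∀ {π σ : Partition W} → π ≼ σ → Partition._∼_ π ⇒ Partition._∼_ σ
  ≼⇒⇒ {π} {σ} π≼σ {x} x∼y with π≼σ x
  ... | _ , ⊆z = σ.trans (σ.sym (⊆z π.refl)) (⊆z x∼y)
    where
    module π = IsEquivalence (Partition.isEquivalence π)
    module σ = IsEquivalence (Partition.isEquivalence σ)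

  ⇒⇒≼ : ∀ {π σ : Partition W} → Partition._∼_ π ⇒ Partition._∼_ σ → π ≼ σ
  ⇒⇒≼ f x = x , f

  -- π ∨ σ is the finest partition coarser than both π and σ.
  isJoinSemilattice : IsJoinSemilattice _≈_ _≼_ _∨_
  isJoinSemilattice = record
    { isPartialOrder = record
      { isPreorder = record
        { isEquivalence = record
          { refl  = (λ p → p) , (λ p → p)
          ; sym   = λ (f , g) → g , f
          ; trans = λ (f , g) (f′ , g′) → (λ p → f′ (f p)) , (λ p → g (g′ p))
          }
        ; reflexive = λ {π} {σ} (f , _) → ⇒⇒≼ {π} {σ} f
        ; trans     = λ {π} {σ} {τ} p q →
            ⇒⇒≼ {π} {τ} (λ r → ≼⇒⇒ {σ} {τ} q (≼⇒⇒ {π} {σ} p r))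
        }
      ; antisym = λ {π} {σ} p q → ≼⇒⇒ {π} {σ} p , ≼⇒⇒ {σ} {π} q
      }
    ; supremum = λ π σ →
        ⇒⇒≼ {π} {π ∨ σ} (λ p → EqC.return (inj₁ p))
      , ⇒⇒≼ {σ} {π ∨ σ} (λ p → EqC.return (inj₂ p))
      , λ ρ p q → ⇒⇒≼ {π ∨ σ} {ρ}
          (EqC.fold (Partition.isEquivalence ρ)
            [ ≼⇒⇒ {π} {ρ} p , ≼⇒⇒ {σ} {ρ} q ])
    }

record Graph (W : Set) : Set₁ where
  field
    Adj     : Rel W 0ℓ
    adj-sym : Symmetric Adj
    adj-irr : Irreflexive _≡_ Adj

open Graph

module _ {W : Set} where

  infixr 6 _∪_

  _∪_ : Graph W → Graph W → Graph W
  G ∪ H = record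
    { Adj     = Adj G Union.∪ Adj H
    ; adj-sym = [ (λ p → inj₁ (adj-sym G p)) , (λ p → inj₂ (adj-sym H p)) ]
    ; adj-irr = λ eq → [ adj-irr G eq , adj-irr H eq ]
    }

  Reachable : Graph W → Rel W 0ℓ
  Reachable H = Star (Adj H)

  cc : Graph W → Partition W
  cc H = record
    { _∼_           = Reachable H
    ; isEquivalence = record
      { refl  = Star.ε
      ; sym   = Star.reverse (adj-sym H)
      ; trans = Star._◅◅_
      }
    }

  -- Nonemptiness of W is not part of this definition; the vertex set X below
  -- always contains the point bot.
  Connected : Graph W → Set
  Connected H = ∀ x y → Reachable H x y

-- Residues modulo n are represented by Fin n.
module Residue (n : ℕ) .{{_ : NonZero n}} where

  infixl 6 _+_

  0# : Fin n
  0# = 0 mod n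

  _+_ : Fin n → Fin n → Fin n
  s + t = (toℕ s +ℕ toℕ t) mod n

module AdditiveShift
  (k q ℓ : ℕ) (ℓ-prime : Prime ℓ) (α : Fin q → Fin ℓ)
  where

  open Residue ℓ {{prime⇒nonZero ℓ-prime}}

  data X : Set where
    bot  : X
    node : Subset k → Fin ℓ → X

  data Edge (i : Fin k) (a : Fin q) : Rel X 0ℓ where
    base  : ∀ S → Edge i a bot (node S 0#)
    shift : ∀ S t → i ∉ S → Edge i a (node S t) (node (S ∪ˢ ⁅ i ⁆) (t + α a))

  private
    S≢S∪i : ∀ {i : Fin k} {S} → i ∉ S → S ≡ S ∪ˢ ⁅ i ⁆ → ∀ {A : Set} → A
    S≢S∪i {i} {S} i∉S eq =
      ⊥-elim (i∉S (subst (i ∈_) (sym eq)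
        (q⊆p∪q S ⁅ i ⁆ (x∈⁅x⁆ i))))

    node-injˡ : ∀ {S S′ t t′} → node S t ≡ node S′ t′ → S ≡ S′
    node-injˡ refl = refl

    edge-irr : ∀ {i a} → Irreflexive _≡_ (Edge i a)
    edge-irr eq (shift S t i∉S) = S≢S∪i i∉S (node-injˡ eq)

  J : Fin k → Fin q → Graph X
  J i a = record
    { Adj     = SymClosure (Edge i a)
    ; adj-sym = Sym.symmetric (Edge i a)
    ; adj-irr = λ { eq (Sym.fwd e) → edge-irr eq e
                  ; eq (Sym.bwd e) → edge-irr (sym eq) e }
    }

  E : Fin k → Fin q → Partition X
  E i a = cc (J i a)

{-# OPTIONS --safe #-}
-- From (S , t) with i ∉ S, an edge of J i a up followed by an edge of J i b
-- down leads to (S , t + α a − α b). As ℓ is prime, the nonzero residue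
-- α a − α b generates ℤ/ℓ, so the whole fibre over S is joined to (S , 0) and
-- thus to ⊥; every vertex over S ∪ {i} has a J i a-neighbour over S.
module Submission where

open import Defs
open import Data.Fin using (Fin; zero; suc; toℕ; _≟_)
open import Data.Fin.Properties using (toℕ-fromℕ<; toℕ-injective; toℕ<n)
open import Data.Fin.Subset using (Subset; _∈_; _∉_; ⁅_⁆; _⊆_; _-_) renaming (_∪_ to _∪ˢ_)
open import Data.Fin.Subset.Properties
  using (_∈?_; ⊆-antisym; x∈p∪q⁺; x∈p∪q⁻; x∈⁅x⁆; x∈⁅y⁆⇒x≡y; p─q⊆p; x∈p∧x≢y⇒x∈p-y)
open import Data.Nat
  using (ℕ; zero; suc; NonZero; _+_; _∸_; _≤_; _<_; _*_; _^_; _⊔_; >-nonZero)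
open import Data.Nat.Coprimality using (prime⇒coprime; coprime-Bézout)
open import Data.Nat.DivMod
  using (_%_; _mod_; m%n<n; m%n%n≡m%n; m<n⇒m%n≡m; %-distribˡ-+; [m+n]%n≡m%n; [m+kn]%n≡m%n)
open import Data.Nat.GCD using (module Bézout)
open import Data.Nat.Primality using (Prime; prime⇒nonZero)
open import Data.Nat.Properties hiding (_≟_)
open import Data.Nat.Tactic.RingSolver using (solve-∀)
open import Data.Product using (_×_; _,_)
open import Data.Sum using (inj₁; inj₂; swap)
open import Data.Unit using (tt)
open import Data.Vec using (_∷_; there)
open import Function.Definitions using (Injective)
open import Relation.Binary using (tri<; tri≈; tri>)
import Relation.Binary.Construct.Closure.ReflexiveTransitive as Star
open Star using (ε; _◅_; _◅◅_)
open import Relation.Binary.Construct.Closure.Symmetric using (fwd; bwd)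
open import Relation.Binary.PropositionalEquality
  using (_≡_; _≢_; refl; sym; trans; cong; subst; subst₂; module ≡-Reasoning)
open import Relation.Nullary using (yes; no; contradiction)

x∉p-x : ∀ {n} (p : Subset n) x → x ∉ p - x
x∉p-x (_ ∷ _) zero    ()
x∉p-x (_ ∷ p) (suc x) (there x∈) = x∉p-x p x x∈

-- Brings a set containing `x` into the form that the upper end of a `shift` edge has.
x∈p⇒p-x∪⁅x⁆≡p : ∀ {n} {p : Subset n} {x} → x ∈ p → (p - x) ∪ˢ ⁅ x ⁆ ≡ p
x∈p⇒p-x∪⁅x⁆≡p {p = p} {x} x∈p = ⊆-antisym to from
  where
  to : (p - x) ∪ˢ ⁅ x ⁆ ⊆ p
  to y∈ with x∈p∪q⁻ (p - x) ⁅ x ⁆ y∈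
  ... | inj₁ y∈p-x = p─q⊆p p ⁅ x ⁆ y∈p-x
  ... | inj₂ y∈⁅x⁆ = subst (_∈ p) (sym (x∈⁅y⁆⇒x≡y x y∈⁅x⁆)) x∈p
  from : p ⊆ (p - x) ∪ˢ ⁅ x ⁆
  from {y} y∈p with y ≟ x
  ... | yes refl = x∈p∪q⁺ (inj₂ (x∈⁅x⁆ x))
  ... | no y≢x   = x∈p∪q⁺ (inj₁ (x∈p∧x≢y⇒x∈p-y y∈p y≢x))

module _ (n : ℕ) .{{_ : NonZero n}} where

  open Residue n renaming (_+_ to _⊕_)

  mod-cong : ∀ {m o} → m % n ≡ o % n → m mod n ≡ o mod n
  mod-cong {m} {o} eq = toℕ-injective (begin
    toℕ (m mod n) ≡⟨ toℕ-fromℕ< (m%n<n m n) ⟩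
    m % n         ≡⟨ eq ⟩
    o % n         ≡⟨ toℕ-fromℕ< (m%n<n o n) ⟨
    toℕ (o mod n) ∎)
    where open ≡-Reasoning

  toℕ-mod : ∀ t → toℕ t mod n ≡ t
  toℕ-mod t = toℕ-injective
    (trans (toℕ-fromℕ< (m%n<n (toℕ t) n)) (m<n⇒m%n≡m (toℕ<n t)))

  -- Lets sums of residues be computed on natural-number representatives, with a single reduction at
  -- the end.
  mod-⊕ : ∀ m t → (m mod n) ⊕ t ≡ (m + toℕ t) mod n
  mod-⊕ m t = mod-cong (begin
    (toℕ (m mod n) + toℕ t) % n     ≡⟨ cong (λ r → (r + toℕ t) % n) (toℕ-fromℕ< (m%n<n m n)) ⟩
    (m % n + toℕ t) % n             ≡⟨ %-distribˡ-+ (m % n) (toℕ t) n ⟩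
    (m % n % n + toℕ t % n) % n     ≡⟨ cong (λ r → (r + toℕ t % n) % n) (m%n%n≡m%n m n) ⟩
    (m % n + toℕ t % n) % n         ≡⟨ %-distribˡ-+ m (toℕ t) n ⟨
    (m + toℕ t) % n                 ∎)
    where open ≡-Reasoning

  -- The left summand represents `s - t`; adding `n` before subtracting keeps the truncated
  -- subtraction exact.
  ⊕-surjective : ∀ s t → ((toℕ s + (n ∸ toℕ t)) mod n) ⊕ t ≡ s
  ⊕-surjective s t = begin
    ((toℕ s + (n ∸ toℕ t)) mod n) ⊕ t   ≡⟨ mod-⊕ (toℕ s + (n ∸ toℕ t)) t ⟩
    (toℕ s + (n ∸ toℕ t) + toℕ t) mod n ≡⟨ cong (_mod n) (+-assoc (toℕ s) _ _) ⟩
    (toℕ s + (n ∸ toℕ t + toℕ t)) mod n ≡⟨ cong (λ r → (toℕ s + r) mod n) (m∸n+n≡m (<⇒≤ (toℕ<n t))) ⟩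
    (toℕ s + n) mod n                   ≡⟨ mod-cong ([m+n]%n≡m%n (toℕ s) n) ⟩
    toℕ s mod n                         ≡⟨ toℕ-mod s ⟩
    s                                   ∎
    where open ≡-Reasoning

module _ {k q ℓ : ℕ} (ℓ-prime : Prime ℓ) (α : Fin q → Fin ℓ) (i : Fin k) where

  open AdditiveShift k q ℓ ℓ-prime α

  private instance
    ℓ-nonZero : NonZero ℓ
    ℓ-nonZero = prime⇒nonZero ℓ-prime

  shift-mod : ∀ c {S} m → i ∉ S →
              Graph.Adj (J i c) (node S (m mod ℓ)) (node (S ∪ˢ ⁅ i ⁆) ((m + toℕ (α c)) mod ℓ))
  shift-mod c {S} m i∉S =
    subst (λ t → Graph.Adj (J i c) (node S (m mod ℓ)) (node (S ∪ˢ ⁅ i ⁆) t))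
      (mod-⊕ ℓ m (α c)) (fwd (shift S (m mod ℓ) i∉S))

  module _ (a b : Fin q) where

    infix 4 _~_
    _~_ : X → X → Set
    _~_ = Reachable (J i a ∪ J i b)

    ~-sym : ∀ {x y} → x ~ y → y ~ x
    ~-sym = Star.reverse (Graph.adj-sym (J i a ∪ J i b))

    module _ (αb<αa : toℕ (α b) < toℕ (α a)) where

      -- The difference is exact because `αb<αa`, and `0 < d < ℓ` makes it coprime to the prime `ℓ`.
      d : ℕ
      d = toℕ (α a) ∸ toℕ (α b)

      translate : ∀ {S} m → i ∉ S → node S (m mod ℓ) ~ node S ((m + d) mod ℓ)
      translate {S} m i∉S = inj₁ (shift-mod a m i∉S) ◅ ~-sym
        (subst (λ r → node S ((m + d) mod ℓ) ~ node (S ∪ˢ ⁅ i ⁆) (r mod ℓ))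
          -- Since `d + α b = α a`, both edges end at the same vertex over `S ∪ {i}`.
          (trans (+-assoc m d _) (cong (m +_) (m∸n+n≡m (<⇒≤ αb<αa))))
          (inj₂ (shift-mod b (m + d) i∉S) ◅ ε))

      translate* : ∀ {S} c m → i ∉ S → node S (m mod ℓ) ~ node S ((m + c * d) mod ℓ)
      translate* {S} zero m i∉S =
        subst (λ r → node S (m mod ℓ) ~ node S (r mod ℓ)) (sym (+-identityʳ m)) ε
      translate* {S} (suc c) m i∉S = translate m i∉S ◅◅
        subst (λ r → node S ((m + d) mod ℓ) ~ node S (r mod ℓ))
          (+-assoc m d (c * d)) (translate* c (m + d) i∉S)

      -- A Bézout coefficient `y` of `d` is an inverse of `d` modulo `ℓ` up to sign, so `t * y`
      -- translations by `d` move by `t` or by `-t`. Over the naturals the sign splits into two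
      -- cases.
      0~ : ∀ {S} → i ∉ S → ∀ t → node S (0 mod ℓ) ~ node S t
      0~ {S} i∉S t
        with coprime-Bézout (prime⇒coprime ℓ-prime {{>-nonZero (m<n⇒0<n∸m αb<αa)}}
               (≤-<-trans (m∸n≤m (toℕ (α a)) (toℕ (α b))) (toℕ<n (α a))))
      -- Here `1 + x * ℓ = y * d`, so `y * d` is 1 modulo `ℓ` and the walk from 0 ends at `t`.
      ... | Bézout.-+ x y eq =
        subst (λ s → node S (0 mod ℓ) ~ node S s) (trans (mod-cong ℓ t*y*d≡t) (toℕ-mod ℓ t))
          (translate* (toℕ t * y) 0 i∉S)
        where
        open ≡-Reasoning
        t*y*d≡t : (toℕ t * y * d) % ℓ ≡ toℕ t % ℓ
        t*y*d≡t = begin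
          (toℕ t * y * d) % ℓ           ≡⟨ cong (_% ℓ) (*-assoc (toℕ t) y d) ⟩
          (toℕ t * (y * d)) % ℓ         ≡⟨ cong (λ r → (toℕ t * r) % ℓ) eq ⟨
          (toℕ t * (1 + x * ℓ)) % ℓ     ≡⟨ cong (_% ℓ) (distrib (toℕ t) x ℓ) ⟩
          (toℕ t + toℕ t * x * ℓ) % ℓ   ≡⟨ [m+kn]%n≡m%n (toℕ t) (toℕ t * x) ℓ ⟩
          toℕ t % ℓ                     ∎
          where
          distrib : ∀ t x l → t * (1 + x * l) ≡ t + t * x * l
          distrib = solve-∀
      -- Here `1 + y * d = x * ℓ`, so `y * d` is -1 modulo `ℓ`: the walk runs from `t` down to 0 and
      -- is then reversed.
      ... | Bézout.+- x y eq = ~-sym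
        (subst₂ (λ s s′ → node S s ~ node S s′) (toℕ-mod ℓ t) (mod-cong ℓ t+t*y*d≡0)
          (translate* (toℕ t * y) (toℕ t) i∉S))
        where
        open ≡-Reasoning
        t+t*y*d≡0 : (toℕ t + toℕ t * y * d) % ℓ ≡ 0 % ℓ
        t+t*y*d≡0 = begin
          (toℕ t + toℕ t * y * d) % ℓ   ≡⟨ cong (_% ℓ) (distrib (toℕ t) y d) ⟨
          (toℕ t * (1 + y * d)) % ℓ     ≡⟨ cong (λ r → (toℕ t * r) % ℓ) eq ⟩
          (toℕ t * (x * ℓ)) % ℓ         ≡⟨ cong (_% ℓ) (*-assoc (toℕ t) x ℓ) ⟨
          (0 + toℕ t * x * ℓ) % ℓ       ≡⟨ [m+kn]%n≡m%n 0 (toℕ t * x) ℓ ⟩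
          0 % ℓ                         ∎
          where
          distrib : ∀ t y d → t * (1 + y * d) ≡ t + t * y * d
          distrib = solve-∀

      bot~node : ∀ {S} → i ∉ S → ∀ t → bot ~ node S t
      bot~node {S} i∉S t = inj₁ (fwd (base S)) ◅ 0~ i∉S t

      bot~ : ∀ x → bot ~ x
      bot~ bot = ε
      bot~ (node S t) with i ∈? S
      ... | no i∉S  = bot~node i∉S t
      -- The vertex is the upper end of the `J i a` edge from `(S - i, s)`, where `s` is `t - α a`
      -- modulo `ℓ`.
      ... | yes i∈S = bot~node (x∉p-x S i) s ◅◅
        subst₂ (λ S′ t′ → node (S - i) s ~ node S′ t′)
          (x∈p⇒p-x∪⁅x⁆≡p i∈S) (⊕-surjective ℓ t (α a))
          (inj₁ (fwd (shift (S - i) s (x∉p-x S i))) ◅ ε)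
        where
        s : Fin ℓ
        s = (toℕ t + (ℓ ∸ toℕ (α a))) mod ℓ

      connected-< : Connected (J i a ∪ J i b)
      connected-< x y = ~-sym (bot~ x) ◅◅ bot~ y

  connected : ∀ a b → α a ≢ α b → Connected (J i a ∪ J i b)
  connected a b αa≢αb with <-cmp (toℕ (α a)) (toℕ (α b))
  -- The roles of `a` and `b` are exchanged; `swap` reorders the two graphs edge by edge.
  ... | tri< αa<αb _ _ = λ x y → Star.map swap (connected-< b a αa<αb x y)
  ... | tri≈ _ αa≡αb _ = contradiction (toℕ-injective αa≡αb) αa≢αb
  ... | tri> _ _ αb<αa = connected-< a b αb<αa

module _ {W : Set} {G H : Graph W} where

  -- Each edge is a one-step walk in its own graph, hence lies within a block of one of the two
  -- partitions. This carries connectedness of the union over to the join.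
  Reachable-∪⇒∨ : ∀ {x y} → Reachable (G ∪ H) x y → Partition._∼_ (cc G ∨ cc H) x y
  Reachable-∪⇒∨ = Star.map λ where
    (inj₁ e) → fwd (inj₁ (e ◅ ε))
    (inj₂ e) → fwd (inj₂ (e ◅ ε))

lemma3p3 : (k q : ℕ) → 1 ≤ k → 1 ≤ q →
    (ℓ : ℕ) (ℓ-prime : Prime ℓ) → q ⊔ 2 ^ k < ℓ → ℓ < 2 * (q ⊔ 2 ^ k) →
    (α : Fin q → Fin ℓ) → Injective _≡_ _≡_ α →
    (i : Fin k) (a b : Fin q) → a ≢ b →
    let open AdditiveShift k q ℓ ℓ-prime α in
    (E i a ∨ E i b ≈ 𝟏) × Connected (J i a ∪ J i b)
lemma3p3 k q _ _ ℓ ℓ-prime _ _ α α-inj i a b a≢b =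
  ((λ _ → tt) , λ {x} {y} _ → Reachable-∪⇒∨ {G = J i a} {J i b} (conn x y)) , conn
  where
  open AdditiveShift k q ℓ ℓ-prime α
  conn : Connected (J i a ∪ J i b)
  conn = connected ℓ-prime α i a b λ αa≡αb → a≢b (α-inj αa≡αb)
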